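{- Let $n$ be a positive integer, let $\mathcal{F}$ be a family of subsets of $[n]$ with $m=|\mathcal{F}|$, let $t$ be a positive integer with $t\le \frac12\log_2 m$, and let $D$ be the set of integers $j$ with $|j|\le i$, where $i=\sqrt{\frac{3n\ln(2m)}{t}}$. Then $\beta_D(\mathcal{F})\le t$. Moreover, if $A_1',\dots,A_t'$ are chosen independently, each being a random subset of $[n]$ containing each point of $[n]$ independently with probability $1/2$, then $\{A_1',\dots,A_t'\}$ is a $D$-secting family for $\mathcal{F}$ with probability greater than $1/2$; hence repeating this random choice until success yields a $D$-secting family of cardinality $t$ after an expected number of at most two iterations.
   Context: For a positive integer $n$, $[n]=\{1,\dots,n\}$. For a set $D$ of integers and families $\mathcal{F},\mathcal{F}'$ of subsets of $[n]$, $\mathcal{F}'$ is called $D$-secting for $\mathcal{F}$ if for every $A\in\mathcal{F}$ there exists $A'\in\mathcal{F}'$ with $|A\cap A'|-|A\cap([n]\setminus A')|\in D$. $\beta_D(\mathcal{F})$ denotes the minimum cardinality of a $D$-secting family for $\mathcal{F}$. -}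

module Defs where

open import Data.Nat using (ℕ; zero; suc; _+_; _*_; _^_; _≤_)
open import Data.Nat using (_!)
open import Data.Integer as ℤ using (ℤ; +_; _-_)
open import Data.Fin using (Fin)
open import Data.Fin.Subset using (Subset; _∩_; ∁; ∣_∣)
open import Data.Vec using (Vec; []; _∷_; toList)
open import Data.List using (List; []; _∷_; map; concatMap)
open import Data.List.Membership.Propositional using (_∈_)
open import Data.List.Relation.Unary.Any using (Any)
open import Data.Bool using (true; false)

secDiff : ∀ {n} → Subset n → Subset n → ℤ
secDiff A A' = + (∣ A ∩ A' ∣) - + (∣ A ∩ ∁ A' ∣)

-- Scaled partial sums of the exponential series:
-- expSum x R = Σ_{r=0}^{R} x^r · R!/r!   (so expSum x R / R! = Σ_{r≤R} x^r/r!)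
expSum : ℕ → ℕ → ℕ
expSum x zero = 1
expSum x (suc R) = suc R * expSum x R + x ^ suc R

-- e^x ≤ N  (e^x is the supremum of its partial sums Σ_{r≤R} x^r/r!)
ExpLe : ℕ → ℕ → Set
ExpLe x N = ∀ R → expSum x R ≤ N * (R !)

-- j ∈ D, where D = { j ∈ ℤ : |j| ≤ sqrt(3 n ln(2m) / t) }  (t > 0).
-- |j| ≤ sqrt(3n ln(2m)/t)  ⇔  t j² ≤ 3n ln(2m)  ⇔  e^{t j²} ≤ (2m)^{3n}.
InD : (n m t : ℕ) → ℤ → Set
InD n m t j = ExpLe (t * (ℤ.∣ j ∣ * ℤ.∣ j ∣)) ((2 * m) ^ (3 * n))

DSecting : ∀ {n} → (ℤ → Set) → List (Subset n) → List (Subset n) → Set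
DSecting D F F' = ∀ {A} → A ∈ F → Any (λ A' → D (secDiff A A')) F'

allSubsets : (n : ℕ) → List (Subset n)
allSubsets zero = [] ∷ []
allSubsets (suc n) = concatMap (λ s → (true ∷ s) ∷ (false ∷ s) ∷ []) (allSubsets n)

allTuples : (n t : ℕ) → List (Vec (Subset n) t)
allTuples n zero = [] ∷ []
allTuples n (suc t) = concatMap (λ v → map (_∷ v) (allSubsets n)) (allTuples n t)

{-# OPTIONS --safe #-}
-- For a fixed A, the signed sum |A ∩ A'| − |A \ A'| is a sum of at most n random signs, so by
-- Hoeffding it exceeds i in absolute value with probability at most 2e^(-i²/2n) = 2(2m)^(-3/2t).
-- All t choices fail for A with probability at most 2^t (2m)^(-3/2) ≤ 2^(-3/2) / m, and the union
-- bound over the m sets leaves a failure probability below 1/2.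
--
-- To stay in ℕ, and to have a decidable threshold, e is replaced by powers of K/M = 1 + 1/M with M
-- a large multiple of n. From e ≤ (K/M)^K, the test (K/M)^(K t k²) ≤ (2m)^(3n) implies that k lies
-- in D; and if k is the least value failing the test, the Chernoff bound with u = (K/M)^l in place
-- of e^λ still yields Hoeffding's inequality with base (K/M)^M, because
-- (u + 1/u)/2 = cosh(lx) ≤ (cosh x)^(l²) and (cosh x)^(2M) ≤ e^x for e^x = K/M.
-- The discrepancy between the exponents K and M is absorbed by the slack 2^(-3/2) < 1/2.
module Submission where

open import Defs
open import Data.Bool using (true; false; if_then_else_)
open import Data.Bool.Properties using () renaming (_≟_ to _≟ᵇ_)
open import Data.Fin.Subset using (Subset; _∩_; ∁; ∣_∣)
open import Data.Fin.Subset.Properties using (∣p∣≤n)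
open import Data.Integer as ℤ using (_⊖_)
open import Data.Integer.Properties using (∣⊖∣-≤; ∣m⊖n∣≡∣n⊖m∣; ∣m⊝n∣≤m⊔n; [+m]-[+n]≡m⊖n)
open import Data.List using (List; []; _∷_; map; concatMap; filter; length; deduplicate; _++_)
open import Data.List.Membership.Propositional using (_∈_)
open import Data.List.Membership.Propositional.Properties using (∈-map⁻)
open import Data.List.Properties using (length-filter; map-++)
open import Data.List.Relation.Binary.Disjoint.Propositional using (Disjoint)
open import Data.List.Relation.Unary.All as All using (All; []; _∷_; all?)
open import Data.List.Relation.Unary.All.Properties as All using (¬All⇒Any¬; all-filter)
open import Data.List.Relation.Unary.AllPairs as AllPairs using ([]; _∷_)
import Data.List.Relation.Unary.AllPairs.Properties as AllPairs
open import Data.List.Relation.Unary.Any as Any using (Any; here; there; any?)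
import Data.List.Relation.Unary.Any.Properties as Any
open import Data.List.Relation.Unary.Unique.Propositional using (Unique)
import Data.List.Relation.Unary.Unique.Propositional.Properties as Unique
import Data.List.Relation.Unary.Unique.DecPropositional.Properties as DecUnique
open import Data.Nat using (ℕ; zero; suc; _+_; _*_; _^_; _≤_; _<_; z≤n; s≤s; NonZero; _!; >-nonZero; >-nonZero⁻¹; _<?_; _≤?_)
open import Data.Nat.ListAction using (sum)
open import Data.Nat.ListAction.Properties using (sum-++)
open import Data.Nat.Properties
open import Data.Nat.Tactic.RingSolver using (solve-∀)
open import Data.Product using (Σ; ∃; _×_; _,_; proj₁; proj₂)
open import Data.Sum using (_⊎_; inj₁; inj₂)
open import Data.Vec using (Vec; []; _∷_; toList)
open import Data.Vec.Properties using (≡-dec; ∷-injectiveˡ; ∷-injectiveʳ; length-toList)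
open import Function using (_∘_)
open import Level using (Level)
open import Relation.Binary using (DecidableEquality)
open import Relation.Binary.PropositionalEquality using (_≡_; _≢_; refl; sym; trans; cong; cong₂; subst; module ≡-Reasoning)
open import Relation.Nullary using (¬_; Dec; yes; no; does; contradiction)
open import Relation.Unary using (Decidable)

-- Powers of 1 + 1/M and the exponential

^-distribʳ-* : ∀ n a b → (a * b) ^ n ≡ a ^ n * b ^ n
^-distribʳ-* zero a b = refl
^-distribʳ-* (suc n) a b =
  trans (cong (a * b *_) (^-distribʳ-* n a b)) (swap a b (a ^ n) (b ^ n))
  where
  swap : ∀ a b c d → a * b * (c * d) ≡ a * c * (b * d)
  swap = solve-∀

^-swap : ∀ a b c → (a ^ b) ^ c ≡ (a ^ c) ^ b
^-swap a b c = trans (^-*-assoc a b c) (trans (cong (a ^_) (*-comm b c)) (sym (^-*-assoc a c b)))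

^-cancelʳ-≤ : ∀ n .{{_ : NonZero n}} {a b} → a ^ n ≤ b ^ n → a ≤ b
^-cancelʳ-≤ n h = ≮⇒≥ λ b<a → ≤⇒≯ h (^-monoˡ-< n b<a)

^-cancelʳ-< : ∀ n {a b} → a ^ n < b ^ n → a < b
^-cancelʳ-< n h = ≰⇒> λ b≤a → <⇒≱ h (^-monoˡ-≤ n b≤a)

-- Bernoulli's inequality (1 - h)^r ≥ 1 - rh at h = 1/(x + 1), multiplied by (x + 1)^(r + 1).
bernoulli : ∀ x r → suc x ^ r * suc x ≤ x ^ r * suc x + r * suc x ^ r
bernoulli x zero = m≤m+n (1 * suc x) 0
bernoulli x (suc r) = begin
  suc x * p * suc x                             ≡⟨ lhs x p ⟩
  x * (p * suc x) + p * suc x                   ≤⟨ +-monoˡ-≤ _ (*-monoʳ-≤ x (bernoulli x r)) ⟩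
  x * (x ^ r * suc x + r * p) + p * suc x       ≤⟨ m≤m+n _ (r * p) ⟩
  x * (x ^ r * suc x + r * p) + p * suc x + r * p ≡⟨ rhs x p (x ^ r) r ⟩
  x * x ^ r * suc x + suc r * (suc x * p)       ∎
  where
  open ≤-Reasoning
  p = suc x ^ r
  lhs : ∀ x p → suc x * p * suc x ≡ x * (p * suc x) + p * suc x
  lhs = solve-∀
  rhs : ∀ x p z r → x * (z * suc x + r * p) + p * suc x + r * p
                  ≡ x * z * suc x + suc r * (suc x * p)
  rhs = solve-∀

-- The forward difference of a power is at most its derivative at the right end: `bernoulli` with
-- one factor cancelled.
suc-^-≤ : ∀ x r → suc x ^ suc r ≤ x ^ suc r + suc r * suc x ^ r
suc-^-≤ x r = *-cancelʳ-≤ _ _ (suc x) (begin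
  suc x ^ suc r * suc x                              ≤⟨ bernoulli x (suc r) ⟩
  x ^ suc r * suc x + suc r * (suc x * suc x ^ r)    ≡⟨ rearr x (x ^ suc r) (suc x ^ r) r ⟩
  (x ^ suc r + suc r * suc x ^ r) * suc x            ∎)
  where
  open ≤-Reasoning
  rearr : ∀ x p q r → p * suc x + suc r * (suc x * q) ≡ (p + suc r * q) * suc x
  rearr = solve-∀

-- Bernoulli gives (M/(M + 1))^y ≥ 1 - y/(M + 1) ≥ 1/2.
suc-^-≤-2* : ∀ M y → 2 * y ≤ suc M → suc M ^ y ≤ 2 * M ^ y
suc-^-≤-2* M y 2y≤K = *-cancelʳ-≤ _ _ (suc M) (+-cancelʳ-≤ (K^y * suc M) _ _ (begin
  K^y * suc M + K^y * suc M            ≡⟨ double (K^y * suc M) ⟩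
  2 * (K^y * suc M)                    ≤⟨ *-monoʳ-≤ 2 (bernoulli M y) ⟩
  2 * (M ^ y * suc M + y * K^y)        ≡⟨ rearr (M ^ y) (suc M) y K^y ⟩
  2 * M ^ y * suc M + K^y * (2 * y)    ≤⟨ +-monoʳ-≤ _ (*-monoʳ-≤ K^y 2y≤K) ⟩
  2 * M ^ y * suc M + K^y * suc M      ∎))
  where
  open ≤-Reasoning
  K^y = suc M ^ y
  double : ∀ a → a + a ≡ 2 * a
  double = solve-∀
  rearr : ∀ p k y q → 2 * (p * k + y * q) ≡ 2 * p * k + q * (2 * y)
  rearr = solve-∀

-- scaledExpSum K x R / (K^R · R!) is the R-th partial sum of e^(x/K).
scaledExpSum : ℕ → ℕ → ℕ → ℕ
scaledExpSum K x zero = 1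
scaledExpSum K x (suc R) = K * suc R * scaledExpSum K x R + x ^ suc R

-- Convexity: over a step of 1/K, a partial sum of the exponential series grows by at most 1/K times
-- its derivative at the right end, and that derivative is the preceding partial sum.
scaledExpSum-suc : ∀ K x R →
  scaledExpSum K (suc x) (suc R) ≤ scaledExpSum K x (suc R) + suc R * scaledExpSum K (suc x) R
scaledExpSum-suc K x zero = ≤-reflexive (base K x)
  where
  base : ∀ K x → K * 1 * 1 + suc x * 1 ≡ K * 1 * 1 + x * 1 + 1 * 1
  base = solve-∀
scaledExpSum-suc K x (suc R) = begin
  K * r * S' (suc R) + suc x ^ r
    ≤⟨ +-mono-≤ (*-monoʳ-≤ (K * r) (scaledExpSum-suc K x R)) (suc-^-≤ x (suc R)) ⟩
  K * r * (S (suc R) + suc R * S' R) + (x ^ r + r * suc x ^ suc R)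
    ≡⟨ rearr K r (S (suc R)) (suc R) (S' R) (x ^ r) (suc x ^ suc R) ⟩
  K * r * S (suc R) + x ^ r + r * (K * suc R * S' R + suc x ^ suc R) ∎
  where
  open ≤-Reasoning
  r = suc (suc R)
  S = scaledExpSum K x
  S' = scaledExpSum K (suc x)
  rearr : ∀ K r a s b c d → K * r * (a + s * b) + (c + r * d) ≡ K * r * a + c + r * (K * s * b + d)
  rearr = solve-∀

-- e^h ≤ 1/(1 - h) for h = 1/K = 1/(M + 1)
scaledExpSum-step : ∀ M x R → M * scaledExpSum (suc M) (suc x) R ≤ suc M * scaledExpSum (suc M) x R
scaledExpSum-step M x zero = *-monoˡ-≤ 1 (n≤1+n M)
scaledExpSum-step M x (suc R) = +-cancelˡ-≤ (S' (suc R)) _ _ (begin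
  suc M * S' (suc R)                              ≤⟨ *-monoʳ-≤ (suc M) (scaledExpSum-suc (suc M) x R) ⟩
  suc M * (S (suc R) + suc R * S' R)              ≡⟨ rearr (suc M) (S (suc R)) (suc R) (S' R) ⟩
  suc M * suc R * S' R + suc M * S (suc R)        ≤⟨ +-monoˡ-≤ (suc M * S (suc R)) (m≤m+n (suc M * suc R * S' R) _) ⟩
  S' (suc R) + suc M * S (suc R)                  ∎)
  where
  open ≤-Reasoning
  S = scaledExpSum (suc M) x
  S' = scaledExpSum (suc M) (suc x)
  rearr : ∀ K a r b → K * (a + r * b) ≡ K * r * b + K * a
  rearr = solve-∀

scaledExpSum-zero : ∀ K R → scaledExpSum K 0 R ≡ K ^ R * R !
scaledExpSum-zero K zero = refl
scaledExpSum-zero K (suc R) =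
  trans (cong (λ z → K * suc R * z + 0) (scaledExpSum-zero K R)) (rearr K (suc R) (K ^ R) (R !))
  where
  rearr : ∀ K r a b → K * r * (a * b) + 0 ≡ K * a * (r * b)
  rearr = solve-∀

scaledExpSum-* : ∀ K y R → scaledExpSum K (K * y) R ≡ K ^ R * expSum y R
scaledExpSum-* K y zero = refl
scaledExpSum-* K y (suc R) =
  trans (cong₂ (λ a b → K * suc R * a + b) (scaledExpSum-* K y R) (^-distribʳ-* (suc R) K y))
        (rearr K (suc R) (K ^ R) (expSum y R) (y ^ suc R))
  where
  rearr : ∀ K r a b c → K * r * (a * b) + K * a * c ≡ K * a * (r * b + c)
  rearr = solve-∀

-- The step is iterated x times, starting from e^0 = 1; this gives e^(x/K) ≤ (K/M)^x for K = M + 1.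
scaledExpSum-≤ : ∀ M x R → M ^ x * scaledExpSum (suc M) x R ≤ suc M ^ x * (suc M ^ R * R !)
scaledExpSum-≤ M zero R = *-monoʳ-≤ 1 (≤-reflexive (scaledExpSum-zero (suc M) R))
scaledExpSum-≤ M (suc x) R = begin
  M * M ^ x * S (suc x)                      ≡⟨ swap M (M ^ x) (S (suc x)) ⟩
  M ^ x * (M * S (suc x))                    ≤⟨ *-monoʳ-≤ (M ^ x) (scaledExpSum-step M x R) ⟩
  M ^ x * (suc M * S x)                      ≡⟨ swap (suc M) (M ^ x) (S x) ⟨
  suc M * M ^ x * S x                        ≡⟨ *-assoc (suc M) (M ^ x) (S x) ⟩
  suc M * (M ^ x * S x)                      ≤⟨ *-monoʳ-≤ (suc M) (scaledExpSum-≤ M x R) ⟩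
  suc M * (suc M ^ x * (suc M ^ R * R !))    ≡⟨ *-assoc (suc M) (suc M ^ x) _ ⟨
  suc M * suc M ^ x * (suc M ^ R * R !)      ∎
  where
  open ≤-Reasoning
  S = λ x → scaledExpSum (suc M) x R
  swap : ∀ a b c → a * b * c ≡ b * (a * c)
  swap = solve-∀

-- e ≤ (1 + 1/M)^(M + 1)
ExpLe-fromPower : ∀ M .{{_ : NonZero M}} y N →
  suc M ^ (suc M * y) ≤ N * M ^ (suc M * y) → ExpLe y N
ExpLe-fromPower M y N h R =
  *-cancelˡ-≤ (M ^ x) {{m^n≢0 M x}} (*-cancelˡ-≤ (K ^ R) {{m^n≢0 K R}} (begin
  K ^ R * (M ^ x * expSum y R)     ≡⟨ swap (K ^ R) (M ^ x) (expSum y R) ⟩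
  M ^ x * (K ^ R * expSum y R)     ≡⟨ cong (M ^ x *_) (scaledExpSum-* K y R) ⟨
  M ^ x * scaledExpSum K x R       ≤⟨ scaledExpSum-≤ M x R ⟩
  K ^ x * (K ^ R * R !)            ≤⟨ *-monoˡ-≤ _ h ⟩
  N * M ^ x * (K ^ R * R !)        ≡⟨ rearr N (M ^ x) (K ^ R) (R !) ⟩
  K ^ R * (M ^ x * (N * R !))      ∎))
  where
  open ≤-Reasoning
  K = suc M
  x = K * y
  swap : ∀ a b c → a * (b * c) ≡ b * (a * c)
  swap = solve-∀
  rearr : ∀ n m k r → n * m * (k * r) ≡ k * (m * (n * r))
  rearr = solve-∀

-- Hyperbolic cosine

2ab≤a²+b² : ∀ a b → 2 * (a * b) ≤ a * a + b * b
2ab≤a²+b² a b with ≤-total a b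
... | inj₁ a≤b with d , refl ← m≤n⇒∃[o]m+o≡n a≤b = ≤-trans (m≤m+n _ (d * d)) (≤-reflexive (id a d))
  where
  id : ∀ a d → 2 * (a * (a + d)) + d * d ≡ a * a + (a + d) * (a + d)
  id = solve-∀
2ab≤a²+b² a b | inj₂ b≤a with d , refl ← m≤n⇒∃[o]m+o≡n b≤a = ≤-trans (m≤m+n _ (d * d)) (≤-reflexive (id b d))
  where
  id : ∀ b d → 2 * ((b + d) * b) + d * d ≡ (b + d) * (b + d) + b * b
  id = solve-∀

-- From (l + 1)² = 2l + 1 + l²; the part 2l is kept as a power of a², to match the squares `γ` and
-- `σ` in the induction for cosh.
^-suc² : ∀ a l → a ^ (suc l * suc l) ≡ (a * a) ^ l * a * a ^ (l * l)
^-suc² a l = begin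
  a ^ (suc l * suc l)                 ≡⟨ cong (a ^_) (expand l) ⟩
  a ^ (l + l + 1 + l * l)             ≡⟨ ^-distribˡ-+-* a (l + l + 1) (l * l) ⟩
  a ^ (l + l + 1) * a ^ (l * l)       ≡⟨ cong (_* a ^ (l * l)) (^-distribˡ-+-* a (l + l) 1) ⟩
  a ^ (l + l) * (a * 1) * a ^ (l * l) ≡⟨ cong₂ (λ u v → u * v * a ^ (l * l)) square (*-identityʳ a) ⟩
  (a * a) ^ l * a * a ^ (l * l)       ∎
  where
  open ≡-Reasoning
  expand : ∀ l → suc l * suc l ≡ l + l + 1 + l * l
  expand = solve-∀
  square : a ^ (l + l) ≡ (a * a) ^ l
  square = trans (^-distribˡ-+-* a l l) (sym (^-distribʳ-* l a a))

-- For K/M = e^x, powerSum l = K^(2l) + M^(2l) is 2 (KM)^l cosh(lx), and s / (2KM) = cosh x.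
module Cosh (K M : ℕ) .{{_ : NonZero K}} where

  s h : ℕ
  s = K * K + M * M
  h = K * M

  -- The quotient `σ` / `γ` is cosh² x.
  γ σ : ℕ
  γ = (2 * h) * (2 * h)
  σ = s * s

  private instance
    s≢0 : NonZero s
    s≢0 = >-nonZero (≤-trans (>-nonZero⁻¹ (K * K) {{m*n≢0 K K}}) (m≤m+n (K * K) (M * M)))

    σ≢0 : NonZero σ
    σ≢0 = m*n≢0 s s

  powerSum : ℕ → ℕ
  powerSum l = (K * K) ^ l + (M * M) ^ l

  -- The identity cosh((l + 2)x) + cosh(lx) = 2 cosh x cosh((l + 1)x), cleared of denominators.
  powerSum-recurrence : ∀ l → 4 * powerSum (2 + l) + γ * powerSum l ≡ 4 * (s * powerSum (1 + l))
  powerSum-recurrence l = id K M ((K * K) ^ l) ((M * M) ^ l)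
    where
    id : ∀ K M a b →
      4 * (K * K * (K * K * a) + M * M * (M * M * b)) + 2 * (K * M) * (2 * (K * M)) * (a + b)
      ≡ 4 * ((K * K + M * M) * (K * K * a + M * M * b))
    id = solve-∀

  -- cosh((l + 1)x) ≤ cosh(lx) · (cosh x)^(2l + 1)
  powerSum-ratio : ∀ l → 2 * (powerSum (suc l) * γ ^ l) ≤ powerSum l * (s * σ ^ l)
  powerSum-ratio zero = ≤-reflexive (base K M)
    where
    base : ∀ K M → 2 * ((K * K * 1 + M * M * 1) * 1) ≡ 2 * ((K * K + M * M) * 1)
    base = solve-∀
  powerSum-ratio (suc l) =
    -- With c = cosh x, the recurrence and the induction hypothesis give cosh((l + 2)x) ≤ cosh((l +
    -- 1)x) (2c - c^(-2l - 1)). The bracket is at most c^(2l + 3) by the inequality of arithmetic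
    -- and geometric means. The added term moves the subtraction to the other side.
    *-cancelˡ-≤ (2 * S) {{m*n≢0 2 S {{_}} {{m^n≢0 σ (suc l)}}}} (+-cancelʳ-≤ (2 * (d₁ * s * (G * G))) _ _ (begin
    2 * S * (2 * (d₂ * G)) + 2 * (d₁ * s * (G * G))
      ≡⟨ id₁ S d₂ G d₁ s γ (γ ^ l) ⟩
    4 * d₂ * (G * S) + γ * s * (2 * (d₁ * γ ^ l)) * G
      ≤⟨ +-monoʳ-≤ (4 * d₂ * (G * S)) (*-monoˡ-≤ G (*-monoʳ-≤ (γ * s) (powerSum-ratio l))) ⟩
    4 * d₂ * (G * S) + γ * s * (d₀ * (s * σ ^ l)) * G
      ≡⟨ id₂ d₂ G s γ d₀ (σ ^ l) ⟩
    (4 * d₂ + γ * d₀) * (G * S)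
      ≡⟨ cong (_* (G * S)) (powerSum-recurrence l) ⟩
    4 * (s * d₁) * (G * S)
      ≡⟨ id₃ s d₁ G S ⟩
    2 * (s * d₁) * (2 * (G * S))
      ≤⟨ *-monoʳ-≤ (2 * (s * d₁)) (2ab≤a²+b² G S) ⟩
    2 * (s * d₁) * (G * G + S * S)
      ≡⟨ id₄ s d₁ G S ⟩
    2 * S * (d₁ * (s * S)) + 2 * (d₁ * s * (G * G)) ∎))
    where
    open ≤-Reasoning
    G = γ ^ suc l
    S = σ ^ suc l
    d₀ = powerSum l
    d₁ = powerSum (suc l)
    d₂ = powerSum (2 + l)
    id₁ : ∀ S d₂ G d₁ s γ g → 2 * S * (2 * (d₂ * G)) + 2 * (d₁ * s * (γ * g * G))
                             ≡ 4 * d₂ * (G * S) + γ * s * (2 * (d₁ * g)) * G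
    id₁ = solve-∀
    id₂ : ∀ d₂ G s γ d₀ z → 4 * d₂ * (G * (s * s * z)) + γ * s * (d₀ * (s * z)) * G
                           ≡ (4 * d₂ + γ * d₀) * (G * (s * s * z))
    id₂ = solve-∀
    id₃ : ∀ s d G S → 4 * (s * d) * (G * S) ≡ 2 * (s * d) * (2 * (G * S))
    id₃ = solve-∀
    id₄ : ∀ s d G S → 2 * (s * d) * (G * G + S * S) ≡ 2 * S * (d * (s * S)) + 2 * (d * s * (G * G))
    id₄ = solve-∀

  -- cosh(lx) ≤ (cosh x)^(l²)
  powerSum-≤ : ∀ l → powerSum l * (2 * h) ^ (l * l) ≤ 2 * (h ^ l * s ^ (l * l))
  powerSum-≤ zero = ≤-refl
  powerSum-≤ (suc l) = begin
    d₁ * (2 * h) ^ (suc l * suc l)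
      ≡⟨ cong (d₁ *_) (^-suc² (2 * h) l) ⟩
    d₁ * (γ ^ l * (2 * h) * g)
      ≡⟨ id₁ d₁ (γ ^ l) h g ⟩
    2 * (d₁ * γ ^ l) * (h * g)
      ≤⟨ *-monoˡ-≤ (h * g) (powerSum-ratio l) ⟩
    d₀ * (s * σ ^ l) * (h * g)
      ≡⟨ id₂ d₀ s (σ ^ l) h g ⟩
    d₀ * g * (s * σ ^ l * h)
      ≤⟨ *-monoˡ-≤ (s * σ ^ l * h) (powerSum-≤ l) ⟩
    2 * (h ^ l * s ^ (l * l)) * (s * σ ^ l * h)
      ≡⟨ id₃ (h ^ l) (s ^ (l * l)) s (σ ^ l) h ⟩
    2 * (h * h ^ l * (σ ^ l * s * s ^ (l * l)))
      ≡⟨ cong (λ z → 2 * (h * h ^ l * z)) (^-suc² s l) ⟨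
    2 * (h * h ^ l * s ^ (suc l * suc l)) ∎
    where
    open ≤-Reasoning
    g = (2 * h) ^ (l * l)
    d₀ = powerSum l
    d₁ = powerSum (suc l)
    id₁ : ∀ d c h g → d * (c * (2 * h) * g) ≡ 2 * (d * c) * (h * g)
    id₁ = solve-∀
    id₂ : ∀ d s z h g → d * (s * z) * (h * g) ≡ d * g * (s * z * h)
    id₂ = solve-∀
    id₃ : ∀ a b s z h → 2 * (a * b) * (s * z * h) ≡ 2 * (h * a * (z * s * b))
    id₃ = solve-∀

-- (cosh x)^(2M) ≤ e^x where e^x = (M + 1)/M: here cosh x = 1 + 1/(2M(M + 1)).
cosh-≤ : ∀ M → (suc M * suc M + M * M) ^ (2 * M) * M ≤ (2 * (suc M * M)) ^ (2 * M) * suc M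
-- Here cosh x = (X + 1)/X, and Bernoulli gives (X/(X + 1))^(2M) ≥ 1 - 2M/(X + 1) ≥ 1 - 1/(M + 1).
cosh-≤ M = subst (λ z → z ^ (2 * M) * M ≤ Z * suc M) (s≡ M)
  (*-cancelʳ-≤ _ _ (suc X) (+-cancelʳ-≤ (P * suc X) _ _ (begin
    P * M * suc X + P * suc X              ≡⟨ id₁ P M (suc X) ⟩
    suc M * (P * suc X)                    ≤⟨ *-monoʳ-≤ (suc M) (bernoulli X (2 * M)) ⟩
    suc M * (Z * suc X + 2 * M * P)        ≡⟨ id₂ M Z P (suc X) ⟩
    Z * suc M * suc X + P * X              ≤⟨ +-monoʳ-≤ (Z * suc M * suc X) (*-monoʳ-≤ P (n≤1+n X)) ⟩
    Z * suc M * suc X + P * suc X          ∎)))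
  where
  open ≤-Reasoning
  X = 2 * (suc M * M)
  P = suc X ^ (2 * M)
  Z = X ^ (2 * M)
  s≡ : ∀ M → suc (2 * (suc M * M)) ≡ suc M * suc M + M * M
  s≡ = solve-∀
  id₁ : ∀ P M s → P * M * s + P * s ≡ suc M * (P * s)
  id₁ = solve-∀
  id₂ : ∀ M Z P s → suc M * (Z * s + 2 * M * P) ≡ Z * suc M * s + P * (2 * (suc M * M))
  id₂ = solve-∀

-- (cosh y)^(2M) ≤ e^(l²x) where e^x = (M + 1)/M and y = lx, i.e. U/V = e^y.
cosh-power-≤ : ∀ M .{{_ : NonZero M}} l → let U = suc M ^ l ; V = M ^ l in
  (U * U + V * V) ^ (2 * M) * M ^ (l * l) ≤ (2 * (U * V)) ^ (2 * M) * suc M ^ (l * l)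
-- The factor `g ^ 2M` is the denominator of (cosh x)^(2Ml²). Once it is present, `powerSum-≤`
-- replaces cosh(lx) by (cosh x)^(l²), and `tail` is the l²-th power of `cosh-≤`.
cosh-power-≤ M l = *-cancelʳ-≤ _ _ (g ^ 2M) {{m^n≢0 g 2M {{m^n≢0 X L}}}} (begin
  (U * U + V * V) ^ 2M * M ^ L * g ^ 2M
    ≡⟨ id₁ ((U * U + V * V) ^ 2M) (M ^ L) (g ^ 2M) ⟩
  (U * U + V * V) ^ 2M * g ^ 2M * M ^ L
    ≡⟨ cong (_* M ^ L) (^-distribʳ-* 2M (U * U + V * V) g) ⟨
  ((U * U + V * V) * g) ^ 2M * M ^ L
    ≡⟨ cong₂ (λ a b → ((a + b) * g) ^ 2M * M ^ L) (^-distribʳ-* l (suc M) (suc M)) (^-distribʳ-* l M M) ⟨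
  (powerSum l * g) ^ 2M * M ^ L
    ≤⟨ *-monoˡ-≤ (M ^ L) (^-monoˡ-≤ 2M (powerSum-≤ l)) ⟩
  (2 * (h ^ l * s ^ L)) ^ 2M * M ^ L
    ≡⟨ cong (λ a → (2 * (a * s ^ L)) ^ 2M * M ^ L) (^-distribʳ-* l (suc M) M) ⟩
  (2 * (U * V * s ^ L)) ^ 2M * M ^ L
    ≡⟨ cong (λ a → a ^ 2M * M ^ L) (*-assoc 2 (U * V) (s ^ L)) ⟨
  (2 * (U * V) * s ^ L) ^ 2M * M ^ L
    ≡⟨ cong (_* M ^ L) (^-distribʳ-* 2M (2 * (U * V)) (s ^ L)) ⟩
  (2 * (U * V)) ^ 2M * (s ^ L) ^ 2M * M ^ L
    ≡⟨ *-assoc ((2 * (U * V)) ^ 2M) ((s ^ L) ^ 2M) (M ^ L) ⟩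
  (2 * (U * V)) ^ 2M * ((s ^ L) ^ 2M * M ^ L)
    ≤⟨ *-monoʳ-≤ ((2 * (U * V)) ^ 2M) tail ⟩
  (2 * (U * V)) ^ 2M * (g ^ 2M * suc M ^ L)
    ≡⟨ id₂ ((2 * (U * V)) ^ 2M) (g ^ 2M) (suc M ^ L) ⟩
  (2 * (U * V)) ^ 2M * suc M ^ L * g ^ 2M ∎)
  where
  open ≤-Reasoning
  open Cosh (suc M) M
  2M = 2 * M
  L = l * l
  U = suc M ^ l
  V = M ^ l
  X = 2 * (suc M * M)
  g = X ^ L
  instance
    X≢0 : NonZero X
    X≢0 = m*n≢0 2 (suc M * M) {{_}} {{m*n≢0 (suc M) M}}
  tail : (s ^ L) ^ 2M * M ^ L ≤ g ^ 2M * suc M ^ L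
  tail = begin
    (s ^ L) ^ 2M * M ^ L       ≡⟨ cong (_* M ^ L) (^-swap s L 2M) ⟩
    (s ^ 2M) ^ L * M ^ L       ≡⟨ ^-distribʳ-* L (s ^ 2M) M ⟨
    (s ^ 2M * M) ^ L           ≤⟨ ^-monoˡ-≤ L (cosh-≤ M) ⟩
    (X ^ 2M * suc M) ^ L       ≡⟨ ^-distribʳ-* L (X ^ 2M) (suc M) ⟩
    (X ^ 2M) ^ L * suc M ^ L   ≡⟨ cong (_* suc M ^ L) (^-swap X 2M L) ⟩
    g ^ 2M * suc M ^ L         ∎
  id₁ : ∀ a b c → a * b * c ≡ a * c * b
  id₁ = solve-∀
  id₂ : ∀ a b c → a * (b * c) ≡ a * c * b
  id₂ = solve-∀

-- Numerical form of the tail bound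

-- The Chernoff bound B ≤ 2 (u + 1/u)^n / u^k at u = (1 + 1/M)^(kq), where M = nq (the
-- discrete form of u = e^(k/n)) gives B ≤ 2^(n + 1) (1 + 1/M)^(-Mk²/(2n)).
hoeffding-fromChernoff : ∀ n q k B .{{_ : NonZero n}} .{{_ : NonZero q}} →
  let M = n * q ; U = suc M ^ (k * q) ; V = M ^ (k * q) in
  B * (U ^ k * (U * V) ^ n) ≤ 2 * ((U * U + V * V) ^ n * V ^ k) →
  B ^ (2 * n) * suc M ^ (M * (k * k)) ≤ 2 ^ (2 * n * suc n) * M ^ (M * (k * k))
-- The Chernoff bound is raised to the power 2M = 2nq, where `cosh-power-≤` applies; a q-th root at
-- the end reduces this exponent to 2n.
hoeffding-fromChernoff n q k B chernoff = ^-cancelʳ-≤ q (begin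
  (B ^ (2 * n) * K ^ z) ^ q
    ≡⟨ ^-distribʳ-* q (B ^ (2 * n)) (K ^ z) ⟩
  (B ^ (2 * n)) ^ q * (K ^ z) ^ q
    ≡⟨ cong₂ _*_ (trans (^-*-assoc B (2 * n) q) (cong (B ^_) (*-assoc 2 n q))) (^-*-assoc K z q) ⟩
  b * κ
    ≤⟨ *-cancelʳ-≤ _ _ (η * κ) {{ηκ≢0}} main ⟩
  c * c' * μ
    ≡⟨ cong₂ _*_ two (sym (^-*-assoc M z q)) ⟩
  (2 ^ (2 * n * suc n)) ^ q * (M ^ z) ^ q
    ≡⟨ ^-distribʳ-* q (2 ^ (2 * n * suc n)) (M ^ z) ⟨
  (2 ^ (2 * n * suc n) * M ^ z) ^ q ∎)
  where
  open ≤-Reasoning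
  M = n * q
  K = suc M
  l = k * q
  2M = 2 * M
  U = K ^ l
  V = M ^ l
  W = U * U + V * V
  H = U * V
  z = M * (k * k)
  -- In powers of 1 + 1/M, the factor u^k contributes the exponent 2e to the left side, and the n
  -- factors cosh(ln u) contribute at most e to the right. The net gain is e.
  e = z * q
  b = B ^ 2M
  κ = K ^ e
  μ = M ^ e
  η = (H ^ n) ^ 2M
  w = (W ^ n) ^ 2M
  c = 2 ^ 2M
  c' = (2 ^ 2M) ^ n
  instance
    M≢0 : NonZero M
    M≢0 = m*n≢0 n q
  H≢0 : NonZero H
  H≢0 = m*n≢0 U V {{m^n≢0 K l}} {{m^n≢0 M l}}
  ηκ≢0 : NonZero (η * κ)
  ηκ≢0 = m*n≢0 η κ {{m^n≢0 (H ^ n) 2M {{m^n≢0 H n {{H≢0}}}}}} {{m^n≢0 K e}}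
  two : c * c' ≡ (2 ^ (2 * n * suc n)) ^ q
  two = trans (cong (c *_) (^-*-assoc 2 2M n)) (trans (sym (^-distribˡ-+-* 2 2M (2M * n)))
        (trans (cong (2 ^_) (id n q)) (sym (^-*-assoc 2 (2 * n * suc n) q))))
    where
    id : ∀ n q → 2 * (n * q) + 2 * (n * q) * n ≡ 2 * n * suc n * q
    id = solve-∀
  tower : ∀ a → ((a ^ l) ^ k) ^ 2M ≡ a ^ e * a ^ e
  tower a = trans (cong (_^ 2M) (^-*-assoc a l k)) (trans (^-*-assoc a (l * k) 2M)
            (trans (cong (a ^_) (id n q k)) (^-distribˡ-+-* a e e)))
    where
    id : ∀ n q k → k * q * k * (2 * (n * q)) ≡ n * q * (k * k) * q + n * q * (k * k) * q
    id = solve-∀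
  square : ∀ a → (a ^ (l * l)) ^ n ≡ a ^ e
  square a = trans (^-*-assoc a (l * l) n) (cong (a ^_) (id n q k))
    where
    id : ∀ n q k → k * q * (k * q) * n ≡ n * q * (k * k) * q
    id = solve-∀
  powered : b * (κ * κ * η) ≤ c * (w * (μ * μ))
  powered = begin
    b * (κ * κ * η)                      ≡⟨ cong (λ x → b * (x * η)) (tower K) ⟨
    b * ((U ^ k) ^ 2M * η)               ≡⟨ cong (b *_) (^-distribʳ-* 2M (U ^ k) (H ^ n)) ⟨
    b * (U ^ k * H ^ n) ^ 2M             ≡⟨ ^-distribʳ-* 2M B (U ^ k * H ^ n) ⟨
    (B * (U ^ k * H ^ n)) ^ 2M           ≤⟨ ^-monoˡ-≤ 2M chernoff ⟩
    (2 * (W ^ n * V ^ k)) ^ 2M           ≡⟨ ^-distribʳ-* 2M 2 (W ^ n * V ^ k) ⟩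
    c * (W ^ n * V ^ k) ^ 2M             ≡⟨ cong (c *_) (^-distribʳ-* 2M (W ^ n) (V ^ k)) ⟩
    c * (w * (V ^ k) ^ 2M)               ≡⟨ cong (λ x → c * (w * x)) (tower M) ⟩
    c * (w * (μ * μ))                    ∎
  cosh : w * μ ≤ c' * η * κ
  cosh = begin
    w * μ                                       ≡⟨ cong₂ _*_ (^-swap W n 2M) (sym (square M)) ⟩
    (W ^ 2M) ^ n * (M ^ (l * l)) ^ n            ≡⟨ ^-distribʳ-* n (W ^ 2M) (M ^ (l * l)) ⟨
    (W ^ 2M * M ^ (l * l)) ^ n                  ≤⟨ ^-monoˡ-≤ n (cosh-power-≤ M l) ⟩
    ((2 * H) ^ 2M * K ^ (l * l)) ^ n            ≡⟨ ^-distribʳ-* n ((2 * H) ^ 2M) (K ^ (l * l)) ⟩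
    ((2 * H) ^ 2M) ^ n * (K ^ (l * l)) ^ n      ≡⟨ cong₂ _*_ (cong (_^ n) (^-distribʳ-* 2M 2 H)) (square K) ⟩
    (c * H ^ 2M) ^ n * κ                        ≡⟨ cong (_* κ) (^-distribʳ-* n c (H ^ 2M)) ⟩
    c' * (H ^ 2M) ^ n * κ                       ≡⟨ cong (λ x → c' * x * κ) (^-swap H 2M n) ⟩
    c' * η * κ                                  ∎
  main : b * κ * (η * κ) ≤ c * c' * μ * (η * κ)
  main = begin
    b * κ * (η * κ)          ≡⟨ id₁ b κ η ⟩
    b * (κ * κ * η)          ≤⟨ powered ⟩
    c * (w * (μ * μ))        ≡⟨ id₂ c w μ ⟩
    c * μ * (w * μ)          ≤⟨ *-monoʳ-≤ (c * μ) cosh ⟩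
    c * μ * (c' * η * κ)     ≡⟨ id₃ c μ c' η κ ⟩
    c * c' * μ * (η * κ)     ∎
    where
    id₁ : ∀ b κ η → b * κ * (η * κ) ≡ b * (κ * κ * η)
    id₁ = solve-∀
    id₂ : ∀ c w μ → c * (w * (μ * μ)) ≡ c * μ * (w * μ)
    id₂ = solve-∀
    id₃ : ∀ c μ d η κ → c * μ * (d * η * κ) ≡ c * d * μ * (η * κ)
    id₃ = solve-∀

-- The choice t ≤ ½ log₂ m makes the union bound over m sets work, with room for the
-- factor (1 + 1/M)^(tk²) ≤ 2 lost by replacing e by (1 + 1/M)^(M + 1).
tail-fromHoeffding : ∀ n t m M k B .{{_ : NonZero n}} .{{_ : NonZero t}} →
  let y = t * (k * k) in
  4 ^ t ≤ m → 2 * y ≤ suc M →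
  (2 * m) ^ (3 * n) * M ^ (suc M * y) < suc M ^ (suc M * y) →
  B ^ (2 * n) * suc M ^ (M * (k * k)) ≤ 2 ^ (2 * n * suc n) * M ^ (M * (k * k)) →
  2 * m * B ^ t < 2 ^ (n * t)
-- The case B = 0 is separate because the other case multiplies a strict inequality by a power of B.
-- Here t ≥ 1 makes `0 ^ t` vanish.
tail-fromHoeffding n (suc t) m M k zero _ _ _ _ =
  subst (_< 2 ^ (n * suc t)) (sym (*-zeroʳ (2 * m))) (m^n>0 2 (n * suc t))
tail-fromHoeffding n t m M k B@(suc _) 4ᵗ≤m 2y≤K N<exp hoeffding =
  -- One of the three factors (2m)^n in `N` pays for 2P: the two-sided factor 2 of the tail bound,
  -- raised to the power 2nt, is P = 4^(tn), and the remaining 2 is the loss in `Nμ<2κ`.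
  ^-cancelʳ-< (2 * n) (*-cancelˡ-< (2 * P) _ _ (begin-strict
    2 * P * (2 * m * B ^ t) ^ (2 * n)
      ≡⟨ cong (2 * P *_) (^-distribʳ-* (2 * n) (2 * m) (B ^ t)) ⟩
    2 * P * ((2 * m) ^ (2 * n) * (B ^ t) ^ (2 * n))
      ≡⟨ cong (λ x → 2 * P * ((2 * m) ^ (2 * n) * x)) (^-swap B t (2 * n)) ⟩
    2 * P * ((2 * m) ^ (2 * n) * b)
      ≡⟨ id₄ (2 * P) ((2 * m) ^ (2 * n)) b ⟩
    b * ((2 * m) ^ (2 * n) * (2 * P))
      ≤⟨ *-monoʳ-≤ b (*-monoʳ-≤ ((2 * m) ^ (2 * n)) slack) ⟩
    b * ((2 * m) ^ (2 * n) * (2 * m) ^ n)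
      ≡⟨ cong (b *_) (trans (sym (^-distribˡ-+-* (2 * m) (2 * n) n)) (cong ((2 * m) ^_) (id₅ n))) ⟩
    b * N
      <⟨ bN<2c ⟩
    2 * c
      ≡⟨ cong (2 *_) c≡ ⟩
    2 * (P * (2 ^ (n * t)) ^ (2 * n))
      ≡⟨ *-assoc 2 P ((2 ^ (n * t)) ^ (2 * n)) ⟨
    2 * P * (2 ^ (n * t)) ^ (2 * n) ∎))
  where
  open ≤-Reasoning
  K = suc M
  y = t * (k * k)
  N = (2 * m) ^ (3 * n)
  P = (4 ^ t) ^ n
  b = (B ^ (2 * n)) ^ t
  c = (2 ^ (2 * n * suc n)) ^ t
  κ = K ^ (M * y)
  μ = M ^ (M * y)
  id₄ : ∀ p x b → p * (x * b) ≡ b * (x * p)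
  id₄ = solve-∀
  id₅ : ∀ n → 2 * n + n ≡ 3 * n
  id₅ = solve-∀
  -- The failed test has the exponent Ky = y + My, while Hoeffding's inequality supplies only My;
  -- the surplus y costs a factor of at most 2.
  Nμ<2κ : N * μ < 2 * κ
  Nμ<2κ = *-cancelˡ-< (M ^ y) _ _ (begin-strict
    M ^ y * (N * μ)       ≡⟨ swap (M ^ y) N μ ⟩
    N * (M ^ y * μ)       ≡⟨ cong (N *_) (^-distribˡ-+-* M y (M * y)) ⟨
    N * M ^ (K * y)       <⟨ N<exp ⟩
    K ^ (K * y)           ≡⟨ ^-distribˡ-+-* K y (M * y) ⟩
    K ^ y * κ             ≤⟨ *-monoˡ-≤ κ (suc-^-≤-2* M y 2y≤K) ⟩
    2 * M ^ y * κ         ≡⟨ swap' (M ^ y) κ ⟩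
    M ^ y * (2 * κ)       ∎)
    where
    swap : ∀ a b c → a * (b * c) ≡ b * (a * c)
    swap = solve-∀
    swap' : ∀ a b → 2 * a * b ≡ a * (2 * b)
    swap' = solve-∀
  bκ≤cμ : b * κ ≤ c * μ
  bκ≤cμ = begin
    b * κ                                              ≡⟨ cong (b *_) (exponent K) ⟨
    b * (K ^ (M * (k * k))) ^ t                        ≡⟨ ^-distribʳ-* t (B ^ (2 * n)) (K ^ (M * (k * k))) ⟨
    (B ^ (2 * n) * K ^ (M * (k * k))) ^ t              ≤⟨ ^-monoˡ-≤ t hoeffding ⟩
    (2 ^ (2 * n * suc n) * M ^ (M * (k * k))) ^ t      ≡⟨ ^-distribʳ-* t (2 ^ (2 * n * suc n)) (M ^ (M * (k * k))) ⟩
    c * (M ^ (M * (k * k))) ^ t                        ≡⟨ cong (c *_) (exponent M) ⟩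
    c * μ                                              ∎
    where
    id : ∀ M k t → M * (k * k) * t ≡ M * (t * (k * k))
    id = solve-∀
    exponent : ∀ a → (a ^ (M * (k * k))) ^ t ≡ a ^ (M * y)
    exponent a = trans (^-*-assoc a (M * (k * k)) t) (cong (a ^_) (id M k t))
  bN<2c : b * N < 2 * c
  bN<2c = *-cancelʳ-< _ _ _ (begin-strict
    b * N * μ         ≡⟨ *-assoc b N μ ⟩
    b * (N * μ)       <⟨ *-monoʳ-< b {{m^n≢0 (B ^ (2 * n)) t {{m^n≢0 B (2 * n)}}}} Nμ<2κ ⟩
    b * (2 * κ)       ≡⟨ swap b κ ⟩
    2 * (b * κ)       ≤⟨ *-monoʳ-≤ 2 bκ≤cμ ⟩
    2 * (c * μ)       ≡⟨ *-assoc 2 c μ ⟨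
    2 * c * μ         ∎)
    where
    swap : ∀ a b → a * (2 * b) ≡ 2 * (a * b)
    swap = solve-∀
  slack : 2 * P ≤ (2 * m) ^ n
  slack = begin
    2 * P                ≤⟨ *-mono-≤ (^-monoʳ-≤ 2 (>-nonZero⁻¹ n)) (^-monoˡ-≤ n 4ᵗ≤m) ⟩
    2 ^ n * m ^ n        ≡⟨ ^-distribʳ-* n 2 m ⟨
    (2 * m) ^ n          ∎
  c≡ : c ≡ P * (2 ^ (n * t)) ^ (2 * n)
  c≡ = trans (^-*-assoc 2 (2 * n * suc n) t) (trans (cong (2 ^_) (id n t))
       (trans (^-distribˡ-+-* 2 (2 * (t * n)) (n * t * (2 * n)))
       (cong₂ _*_ (trans (sym (^-*-assoc 2 2 (t * n))) (sym (^-*-assoc 4 t n)))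
                  (sym (^-*-assoc 2 (n * t) (2 * n))))))
    where
    id : ∀ n t → 2 * n * suc n * t ≡ 2 * (t * n) + n * t * (2 * n)
    id = solve-∀

-- Finite sums

private variable
  a p : Level
  A B : Set a

∑ : List A → (A → ℕ) → ℕ
∑ xs f = sum (map f xs)

∑-mono-≤ : ∀ (xs : List A) {f g : A → ℕ} → (∀ x → f x ≤ g x) → ∑ xs f ≤ ∑ xs g
∑-mono-≤ [] f≤g = z≤n
∑-mono-≤ (x ∷ xs) f≤g = +-mono-≤ (f≤g x) (∑-mono-≤ xs f≤g)

∑-cong : ∀ (xs : List A) {f g : A → ℕ} → (∀ x → f x ≡ g x) → ∑ xs f ≡ ∑ xs g
∑-cong [] f≡g = refl
∑-cong (x ∷ xs) f≡g = cong₂ _+_ (f≡g x) (∑-cong xs f≡g)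

∑-+ : ∀ (xs : List A) (f g : A → ℕ) → ∑ xs (λ x → f x + g x) ≡ ∑ xs f + ∑ xs g
∑-+ [] f g = refl
∑-+ (x ∷ xs) f g = trans (cong (f x + g x +_) (∑-+ xs f g)) (swap (f x) (g x) (∑ xs f) (∑ xs g))
  where
  swap : ∀ a b c d → a + b + (c + d) ≡ a + c + (b + d)
  swap = solve-∀

∑-*ˡ : ∀ (xs : List A) c (f : A → ℕ) → ∑ xs (λ x → c * f x) ≡ c * ∑ xs f
∑-*ˡ [] c f = sym (*-zeroʳ c)
∑-*ˡ (x ∷ xs) c f = trans (cong (c * f x +_) (∑-*ˡ xs c f)) (sym (*-distribˡ-+ c (f x) (∑ xs f)))

∑-*ʳ : ∀ (xs : List A) (f : A → ℕ) c → ∑ xs (λ x → f x * c) ≡ ∑ xs f * c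
∑-*ʳ xs f c = trans (∑-cong xs λ x → *-comm (f x) c) (trans (∑-*ˡ xs c f) (*-comm c (∑ xs f)))

∑-zero : ∀ (xs : List A) → ∑ xs (λ _ → 0) ≡ 0
∑-zero [] = refl
∑-zero (x ∷ xs) = ∑-zero xs

∑-swap : ∀ (xs : List A) (ys : List B) (f : A → B → ℕ) →
  ∑ xs (λ x → ∑ ys (f x)) ≡ ∑ ys (λ y → ∑ xs (λ x → f x y))
∑-swap [] ys f = sym (∑-zero ys)
∑-swap (x ∷ xs) ys f =
  trans (cong (∑ ys (f x) +_) (∑-swap xs ys f)) (sym (∑-+ ys (f x) (λ y → ∑ xs (λ x → f x y))))

∑-++ : ∀ (xs ys : List A) (f : A → ℕ) → ∑ (xs ++ ys) f ≡ ∑ xs f + ∑ ys f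
∑-++ xs ys f = trans (cong sum (map-++ f xs ys)) (sum-++ (map f xs) (map f ys))

∑-concatMap : ∀ (h : A → List B) xs (f : B → ℕ) → ∑ (concatMap h xs) f ≡ ∑ xs (λ x → ∑ (h x) f)
∑-concatMap h [] f = refl
∑-concatMap h (x ∷ xs) f =
  trans (∑-++ (h x) (concatMap h xs) f) (cong (∑ (h x) f +_) (∑-concatMap h xs f))

∑-map : ∀ (h : A → B) xs (f : B → ℕ) → ∑ (map h xs) f ≡ ∑ xs (f ∘ h)
∑-map h [] f = refl
∑-map h (x ∷ xs) f = cong (f (h x) +_) (∑-map h xs f)

Any⇒≤∑ : ∀ {xs : List A} {P : A → Set} {c} {f : A → ℕ} → (∀ {x} → P x → c ≤ f x) → Any P xs → c ≤ ∑ xs f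
Any⇒≤∑ {xs = x ∷ xs} c≤f (here px) = ≤-trans (c≤f px) (m≤m+n _ _)
Any⇒≤∑ {xs = x ∷ xs} {f = f} c≤f (there any) = ≤-trans (Any⇒≤∑ c≤f any) (m≤n+m _ (f x))

-- Integrality turns each strict inequality into a gap of at least 1, and the gaps add up to
-- `length xs`. Strictness thus survives a later division by this length.
∑-average : ∀ (xs : List A) c T (f : A → ℕ) → (∀ x → c * f x < T) →
  c * ∑ xs f + length xs ≤ length xs * T
∑-average [] c T f h = ≤-reflexive (cong (_+ 0) (*-zeroʳ c))
∑-average (x ∷ xs) c T f h = begin
  c * (f x + ∑ xs f) + suc (length xs)          ≡⟨ rearr c (f x) (∑ xs f) (length xs) ⟩
  suc (c * f x) + (c * ∑ xs f + length xs)      ≤⟨ +-mono-≤ (h x) (∑-average xs c T f h) ⟩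
  T + length xs * T                             ∎
  where
  open ≤-Reasoning
  rearr : ∀ c a b l → c * (a + b) + suc l ≡ suc (c * a) + (c * b + l)
  rearr = solve-∀

𝟙 : ∀ {P : Set p} → Dec P → ℕ
𝟙 P? = if does P? then 1 else 0

𝟙-elim : ∀ {P : Set p} (P? : Dec P) (R : ℕ → Set) → (P → R 1) → (¬ P → R 0) → R (𝟙 P?)
𝟙-elim (yes p) R on off = on p
𝟙-elim (no ¬p) R on off = off ¬p

length-filter-∑ : ∀ {P : A → Set p} (P? : Decidable P) xs → length (filter P? xs) ≡ ∑ xs (𝟙 ∘ P?)
length-filter-∑ P? [] = refl
length-filter-∑ P? (x ∷ xs) with does (P? x)
... | true = cong suc (length-filter-∑ P? xs)
... | false = length-filter-∑ P? xs

-- Enumerations of subsets and tuples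

∏ : ∀ {t} → (A → ℕ) → Vec A t → ℕ
∏ f [] = 1
∏ f (x ∷ v) = f x * ∏ f v

∏-one : ∀ {t} (v : Vec A t) → ∏ (λ _ → 1) v ≡ 1
∏-one [] = refl
∏-one (x ∷ v) = trans (+-identityʳ _) (∏-one v)

∑-allSubsets-suc : ∀ n (f : Subset (suc n) → ℕ) →
  ∑ (allSubsets (suc n)) f ≡ ∑ (allSubsets n) (λ s → f (true ∷ s) + f (false ∷ s))
∑-allSubsets-suc n f =
  trans (∑-concatMap _ (allSubsets n) f)
        (∑-cong (allSubsets n) λ s → cong (f (true ∷ s) +_) (+-identityʳ _))

-- Expansion of a power of a sum. In probabilistic terms, the t choices are independent, so the
-- expectation of a product factorises.
∑-allTuples : ∀ n t (f : Subset n → ℕ) → ∑ (allTuples n t) (∏ f) ≡ ∑ (allSubsets n) f ^ t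
∑-allTuples n zero f = refl
∑-allTuples n (suc t) f = begin
  ∑ (allTuples n (suc t)) (∏ f)
    ≡⟨ ∑-concatMap _ (allTuples n t) (∏ f) ⟩
  ∑ (allTuples n t) (λ v → ∑ (map (_∷ v) (allSubsets n)) (∏ f))
    ≡⟨ ∑-cong (allTuples n t) (λ v → trans (∑-map (_∷ v) (allSubsets n) (∏ f)) (∑-*ʳ (allSubsets n) f (∏ f v))) ⟩
  ∑ (allTuples n t) (λ v → ∑ (allSubsets n) f * ∏ f v)
    ≡⟨ ∑-*ˡ (allTuples n t) (∑ (allSubsets n) f) (∏ f) ⟩
  ∑ (allSubsets n) f * ∑ (allTuples n t) (∏ f)
    ≡⟨ cong (∑ (allSubsets n) f *_) (∑-allTuples n t f) ⟩
  ∑ (allSubsets n) f * ∑ (allSubsets n) f ^ t ∎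
  where open ≡-Reasoning

∑-allSubsets-one : ∀ n → ∑ (allSubsets n) (λ _ → 1) ≡ 2 ^ n
∑-allSubsets-one zero = refl
∑-allSubsets-one (suc n) =
  trans (∑-allSubsets-suc n (λ _ → 1)) (trans (∑-*ˡ (allSubsets n) 2 (λ _ → 1)) (cong (2 *_) (∑-allSubsets-one n)))

∑-allTuples-one : ∀ n t → ∑ (allTuples n t) (λ _ → 1) ≡ 2 ^ (n * t)
∑-allTuples-one n t = begin
  ∑ (allTuples n t) (λ _ → 1)            ≡⟨ ∑-cong (allTuples n t) ∏-one ⟨
  ∑ (allTuples n t) (∏ λ _ → 1)          ≡⟨ ∑-allTuples n t (λ _ → 1) ⟩
  ∑ (allSubsets n) (λ _ → 1) ^ t         ≡⟨ cong (_^ t) (∑-allSubsets-one n) ⟩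
  (2 ^ n) ^ t                            ≡⟨ ^-*-assoc 2 n t ⟩
  2 ^ (n * t)                            ∎
  where open ≡-Reasoning

concatMap-unique : ∀ {h : A → List B} → (∀ x → Unique (h x)) →
  (∀ {x y z} → z ∈ h x → z ∈ h y → x ≡ y) → ∀ {xs} → Unique xs → Unique (concatMap h xs)
concatMap-unique {h = h} h-unique h-inj {xs} xs-unique =
  Unique.concat⁺ (All.map⁺ (All.universal h-unique xs))
    (AllPairs.map⁺ (AllPairs.map disjoint xs-unique))
  where
  disjoint : ∀ {x y} → x ≢ y → Disjoint (h x) (h y)
  disjoint x≢y (z∈x , z∈y) = x≢y (h-inj z∈x z∈y)

allSubsets-unique : ∀ n → Unique (allSubsets n)
allSubsets-unique zero = [] ∷ []
allSubsets-unique (suc n) =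
  concatMap-unique (λ s → ((λ ()) ∷ []) ∷ [] ∷ []) inj (allSubsets-unique n)
  where
  tail≡ : ∀ {s : Subset n} {z} → z ∈ (true ∷ s) ∷ (false ∷ s) ∷ [] → Data.Vec.tail z ≡ s
  tail≡ (here refl) = refl
  tail≡ (there (here refl)) = refl
  inj : ∀ {s s' : Subset n} {z} → z ∈ (true ∷ s) ∷ (false ∷ s) ∷ [] →
    z ∈ (true ∷ s') ∷ (false ∷ s') ∷ [] → s ≡ s'
  inj z∈ z∈' = trans (sym (tail≡ z∈)) (tail≡ z∈')

-- In the absence of repetitions, the length of a list of good tuples counts outcomes of the random
-- choice and may be compared with their total number 2^(nt).
allTuples-unique : ∀ n t → Unique (allTuples n t)
allTuples-unique n zero = [] ∷ []
allTuples-unique n (suc t) =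
  concatMap-unique (λ v → Unique.map⁺ ∷-injectiveˡ (allSubsets-unique n)) inj (allTuples-unique n t)
  where
  inj : ∀ {v w : Vec (Subset n) t} {z} →
    z ∈ map (_∷ v) (allSubsets n) → z ∈ map (_∷ w) (allSubsets n) → v ≡ w
  inj z∈v z∈w with ∈-map⁻ _ z∈v | ∈-map⁻ _ z∈w
  ... | _ , _ , refl | _ , _ , eq = ∷-injectiveʳ eq

-- The Chernoff bound

-- weight U V A A' = (UV)^n (U/V)^(secDiff A A')
weight : ∀ {n} → ℕ → ℕ → Subset n → Subset n → ℕ
weight U V [] [] = 1
weight U V (false ∷ A) (_ ∷ A') = U * V * weight U V A A'
weight U V (true ∷ A) (true ∷ A') = U * U * weight U V A A'
weight U V (true ∷ A) (false ∷ A') = V * V * weight U V A A'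

-- With p = |A ∩ A'| and q = |A ∩ ∁A'|, this is the closed form (UV)^n (U/V)^(p - q) multiplied by
-- its denominator V^p U^q.
weight-closed : ∀ {n} U V (A A' : Subset n) →
  weight U V A A' * (V ^ ∣ A ∩ A' ∣ * U ^ ∣ A ∩ ∁ A' ∣) ≡ U ^ ∣ A ∩ A' ∣ * V ^ ∣ A ∩ ∁ A' ∣ * (U * V) ^ n
weight-closed U V [] [] = refl
weight-closed {suc n} U V (false ∷ A) (_ ∷ A') = begin
  U * V * w * x       ≡⟨ *-assoc (U * V) w x ⟩
  U * V * (w * x)     ≡⟨ cong (U * V *_) (weight-closed U V A A') ⟩
  U * V * (y * H)     ≡⟨ swap (U * V) y H ⟩
  y * (U * V * H)     ∎
  where
  open ≡-Reasoning
  w = weight U V A A'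
  x = V ^ ∣ A ∩ A' ∣ * U ^ ∣ A ∩ ∁ A' ∣
  y = U ^ ∣ A ∩ A' ∣ * V ^ ∣ A ∩ ∁ A' ∣
  H = (U * V) ^ n
  swap : ∀ a b c → a * (b * c) ≡ b * (a * c)
  swap = solve-∀
weight-closed {suc n} U V (true ∷ A) (true ∷ A') = begin
  U * U * w * (V * Vp * Uq)       ≡⟨ id₁ U V w Vp Uq ⟩
  U * U * V * (w * (Vp * Uq))     ≡⟨ cong (U * U * V *_) (weight-closed U V A A') ⟩
  U * U * V * (Up * Vq * H)       ≡⟨ id₂ U V Up Vq H ⟩
  U * Up * Vq * (U * V * H)       ∎
  where
  open ≡-Reasoning
  w = weight U V A A'
  Up = U ^ ∣ A ∩ A' ∣
  Vp = V ^ ∣ A ∩ A' ∣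
  Uq = U ^ ∣ A ∩ ∁ A' ∣
  Vq = V ^ ∣ A ∩ ∁ A' ∣
  H = (U * V) ^ n
  id₁ : ∀ U V w a b → U * U * w * (V * a * b) ≡ U * U * V * (w * (a * b))
  id₁ = solve-∀
  id₂ : ∀ U V a b h → U * U * V * (a * b * h) ≡ U * a * b * (U * V * h)
  id₂ = solve-∀
weight-closed {suc n} U V (true ∷ A) (false ∷ A') = begin
  V * V * w * (Vp * (U * Uq))     ≡⟨ id₁ U V w Vp Uq ⟩
  U * V * V * (w * (Vp * Uq))     ≡⟨ cong (U * V * V *_) (weight-closed U V A A') ⟩
  U * V * V * (Up * Vq * H)       ≡⟨ id₂ U V Up Vq H ⟩
  Up * (V * Vq) * (U * V * H)     ∎
  where
  open ≡-Reasoning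
  w = weight U V A A'
  Up = U ^ ∣ A ∩ A' ∣
  Vp = V ^ ∣ A ∩ A' ∣
  Uq = U ^ ∣ A ∩ ∁ A' ∣
  Vq = V ^ ∣ A ∩ ∁ A' ∣
  H = (U * V) ^ n
  id₁ : ∀ U V w a b → V * V * w * (a * (U * b)) ≡ U * V * V * (w * (a * b))
  id₁ = solve-∀
  id₂ : ∀ U V a b h → U * V * V * (a * b * h) ≡ a * (V * b) * (U * V * h)
  id₂ = solve-∀

-- The moment generating function factorises over the points. A point of A contributes U² + V²; any
-- other contributes 2UV, which is no larger, so the bound depends on n alone.
∑-weight : ∀ {n} U V (A : Subset n) → ∑ (allSubsets n) (weight U V A) ≤ (U * U + V * V) ^ n
∑-weight U V [] = ≤-refl
∑-weight {suc n} U V (b ∷ A) = begin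
  ∑ (allSubsets (suc n)) (weight U V (b ∷ A))
    ≡⟨ ∑-allSubsets-suc n (weight U V (b ∷ A)) ⟩
  ∑ (allSubsets n) (λ s → weight U V (b ∷ A) (true ∷ s) + weight U V (b ∷ A) (false ∷ s))
    ≤⟨ ∑-mono-≤ (allSubsets n) (step b) ⟩
  ∑ (allSubsets n) (λ s → (U * U + V * V) * weight U V A s)
    ≡⟨ ∑-*ˡ (allSubsets n) (U * U + V * V) (weight U V A) ⟩
  (U * U + V * V) * ∑ (allSubsets n) (weight U V A)
    ≤⟨ *-monoʳ-≤ (U * U + V * V) (∑-weight U V A) ⟩
  (U * U + V * V) * (U * U + V * V) ^ n ∎
  where
  open ≤-Reasoning
  double : ∀ h w → h * w + h * w ≡ 2 * h * w
  double = solve-∀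
  step : ∀ b s → weight U V (b ∷ A) (true ∷ s) + weight U V (b ∷ A) (false ∷ s)
               ≤ (U * U + V * V) * weight U V A s
  step true s = ≤-reflexive (sym (*-distribʳ-+ (weight U V A s) (U * U) (V * V)))
  step false s = ≤-trans (≤-reflexive (double (U * V) (weight U V A s)))
                         (*-monoˡ-≤ (weight U V A s) (2ab≤a²+b² U V))

deviation : ∀ {n} → Subset n → Subset n → ℕ
deviation A A' = ℤ.∣ secDiff A A' ∣

deviation-⊖ : ∀ {n} (A A' : Subset n) → deviation A A' ≡ ℤ.∣ ∣ A ∩ A' ∣ ⊖ ∣ A ∩ ∁ A' ∣ ∣
deviation-⊖ A A' = cong ℤ.∣_∣ ([+m]-[+n]≡m⊖n ∣ A ∩ A' ∣ ∣ A ∩ ∁ A' ∣)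

deviation-≤ : ∀ {n} (A A' : Subset n) → deviation A A' ≤ n
deviation-≤ A A' = ≤-trans (≤-reflexive (deviation-⊖ A A'))
  (≤-trans (∣m⊝n∣≤m⊔n ∣ A ∩ A' ∣ ∣ A ∩ ∁ A' ∣) (⊔-lub (∣p∣≤n (A ∩ A')) (∣p∣≤n (A ∩ ∁ A'))))

-- Any w with w / H = (U/V)^(p - q) is at least H (U/V)^k when p - q ≥ k.
power-lower : ∀ {U V} .{{_ : NonZero U}} .{{_ : NonZero V}} → V ≤ U → ∀ w H p q k →
  k + q ≤ p → w * (V ^ p * U ^ q) ≡ U ^ p * V ^ q * H → U ^ k * H ≤ w * V ^ k
power-lower {U} {V} V≤U w H p q k k+q≤p eq with d , refl ← m≤n⇒∃[o]m+o≡n k+q≤p =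
  *-cancelʳ-≤ _ _ (U ^ d * (U ^ q * V ^ q)) {{m*n≢0 (U ^ d) _ {{m^n≢0 U d}} {{m*n≢0 (U ^ q) (V ^ q) {{m^n≢0 U q}} {{m^n≢0 V q}}}}}} (begin
    U ^ k * H * (U ^ d * (U ^ q * V ^ q))       ≡⟨ id₁ (U ^ k) (U ^ d) (U ^ q) (V ^ q) H ⟩
    U ^ k * U ^ q * U ^ d * V ^ q * H           ≡⟨ cong (λ x → x * V ^ q * H) (split U) ⟨
    U ^ (k + q + d) * V ^ q * H                 ≡⟨ eq ⟨
    w * (V ^ (k + q + d) * U ^ q)               ≡⟨ cong (λ x → w * (x * U ^ q)) (split V) ⟩
    w * (V ^ k * V ^ q * V ^ d * U ^ q)         ≤⟨ *-monoʳ-≤ w (*-monoˡ-≤ (U ^ q) (*-monoʳ-≤ (V ^ k * V ^ q) (^-monoˡ-≤ d V≤U))) ⟩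
    w * (V ^ k * V ^ q * U ^ d * U ^ q)         ≡⟨ id₂ w (V ^ k) (V ^ q) (U ^ d) (U ^ q) ⟩
    w * V ^ k * (U ^ d * (U ^ q * V ^ q))       ∎)
  where
  open ≤-Reasoning
  split : ∀ x → x ^ (k + q + d) ≡ x ^ k * x ^ q * x ^ d
  split x = trans (^-distribˡ-+-* x (k + q) d) (cong (_* x ^ d) (^-distribˡ-+-* x k q))
  id₁ : ∀ a b c e h → a * h * (b * (c * e)) ≡ a * c * b * e * h
  id₁ = solve-∀
  id₂ : ∀ w a b c e → w * (a * b * c * e) ≡ w * a * (c * (e * b))
  id₂ = solve-∀

-- Exchanging U and V reverses the sign of the difference, so one of the two weights is large
-- whichever sign it has; the sum covers both tails.
weight-lower : ∀ {n} U V .{{_ : NonZero U}} .{{_ : NonZero V}} → V ≤ U → ∀ k (A A' : Subset n) →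
  k ≤ deviation A A' → U ^ k * (U * V) ^ n ≤ (weight U V A A' + weight V U A A') * V ^ k
weight-lower {n} U V V≤U k A A' k≤dev with ≤-total ∣ A ∩ ∁ A' ∣ ∣ A ∩ A' ∣
... | inj₁ q≤p =
  ≤-trans (power-lower V≤U (weight U V A A') ((U * V) ^ n) ∣ A ∩ A' ∣ ∣ A ∩ ∁ A' ∣ k k+q≤p (weight-closed U V A A'))
          (*-monoˡ-≤ (V ^ k) (m≤m+n (weight U V A A') (weight V U A A')))
  where
  k+q≤p : k + ∣ A ∩ ∁ A' ∣ ≤ ∣ A ∩ A' ∣
  k+q≤p = ≤-trans (+-monoˡ-≤ _ (≤-trans k≤dev (≤-reflexive
            (trans (deviation-⊖ A A') (trans (∣m⊖n∣≡∣n⊖m∣ ∣ A ∩ A' ∣ _) (∣⊖∣-≤ q≤p))))))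
          (≤-reflexive (m∸n+n≡m q≤p))
... | inj₂ p≤q =
  ≤-trans (power-lower V≤U (weight V U A A') ((U * V) ^ n) ∣ A ∩ ∁ A' ∣ ∣ A ∩ A' ∣ k k+p≤q closed)
          (*-monoˡ-≤ (V ^ k) (m≤n+m (weight V U A A') (weight U V A A')))
  where
  k+p≤q : k + ∣ A ∩ A' ∣ ≤ ∣ A ∩ ∁ A' ∣
  k+p≤q = ≤-trans (+-monoˡ-≤ _ (≤-trans k≤dev (≤-reflexive (trans (deviation-⊖ A A') (∣⊖∣-≤ p≤q)))))
          (≤-reflexive (m∸n+n≡m p≤q))
  closed : weight V U A A' * (V ^ ∣ A ∩ ∁ A' ∣ * U ^ ∣ A ∩ A' ∣) ≡ U ^ ∣ A ∩ ∁ A' ∣ * V ^ ∣ A ∩ A' ∣ * (U * V) ^ n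
  closed = trans (cong (weight V U A A' *_) (*-comm (V ^ ∣ A ∩ ∁ A' ∣) _))
    (trans (weight-closed V U A A')
           (cong₂ _*_ (*-comm (V ^ ∣ A ∩ A' ∣) _) (cong (_^ n) (*-comm V U))))

far : ∀ {n} → ℕ → Subset n → Subset n → ℕ
far k A A' = 𝟙 (k ≤? deviation A A')

-- Markov's inequality for the sum of the two opposite weights, stated for counts of subsets; the
-- factor 2 comes from the two tails.
chernoff : ∀ {n} U V .{{_ : NonZero U}} .{{_ : NonZero V}} → V ≤ U → ∀ k (A : Subset n) →
  ∑ (allSubsets n) (far k A) * (U ^ k * (U * V) ^ n) ≤ 2 * ((U * U + V * V) ^ n * V ^ k)
chernoff {n} U V V≤U k A = begin
  ∑ (allSubsets n) (far k A) * c
    ≡⟨ ∑-*ʳ (allSubsets n) (far k A) c ⟨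
  ∑ (allSubsets n) (λ s → far k A s * c)
    ≤⟨ ∑-mono-≤ (allSubsets n) markov ⟩
  ∑ (allSubsets n) (λ s → (weight U V A s + weight V U A s) * V ^ k)
    ≡⟨ ∑-*ʳ (allSubsets n) _ (V ^ k) ⟩
  ∑ (allSubsets n) (λ s → weight U V A s + weight V U A s) * V ^ k
    ≡⟨ cong (_* V ^ k) (∑-+ (allSubsets n) (weight U V A) (weight V U A)) ⟩
  (∑ (allSubsets n) (weight U V A) + ∑ (allSubsets n) (weight V U A)) * V ^ k
    ≤⟨ *-monoˡ-≤ (V ^ k) (+-mono-≤ (∑-weight U V A) (∑-weight V U A)) ⟩
  ((U * U + V * V) ^ n + (V * V + U * U) ^ n) * V ^ k
    ≡⟨ cong (λ x → ((U * U + V * V) ^ n + x ^ n) * V ^ k) (+-comm (V * V) (U * U)) ⟩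
  ((U * U + V * V) ^ n + (U * U + V * V) ^ n) * V ^ k
    ≡⟨ double ((U * U + V * V) ^ n) (V ^ k) ⟩
  2 * ((U * U + V * V) ^ n * V ^ k) ∎
  where
  open ≤-Reasoning
  c = U ^ k * (U * V) ^ n
  double : ∀ a b → (a + a) * b ≡ 2 * (a * b)
  double = solve-∀
  markov : ∀ s → far k A s * c ≤ (weight U V A s + weight V U A s) * V ^ k
  markov s = 𝟙-elim (k ≤? deviation A s) (λ x → x * c ≤ (weight U V A s + weight V U A s) * V ^ k)
    (λ k≤dev → ≤-trans (≤-reflexive (+-identityʳ c)) (weight-lower U V V≤U k A s k≤dev))
    (λ _ → z≤n)

-- Thresholds

leastCounterexample : ∀ {Q : ℕ → Set p} → Decidable Q → ∀ b →
  (∀ j → j < b → Q j) ⊎ ∃ λ k → k < b × ¬ Q k × (∀ j → j < k → Q j)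
leastCounterexample Q? zero = inj₁ λ _ ()
leastCounterexample {Q = Q} Q? (suc b) with leastCounterexample Q? b
... | inj₂ (k , k<b , rest) = inj₂ (k , m<n⇒m<1+n k<b , rest)
... | inj₁ below with Q? b
...   | no ¬Qb = inj₂ (b , ≤-refl , ¬Qb , below)
...   | yes Qb = inj₁ upTo
  where
  upTo : ∀ j → j < suc b → Q j
  upTo j (s≤s j≤b) with m≤n⇒m<n∨m≡n j≤b
  ... | inj₁ j<b = below j j<b
  ... | inj₂ refl = Qb

∑-far-suc : ∀ {n} (A : Subset n) → ∑ (allSubsets n) (far (suc n) A) ≡ 0
∑-far-suc {n} A = trans (∑-cong (allSubsets n) far≡0) (∑-zero (allSubsets n))
  where
  far≡0 : ∀ s → far (suc n) A s ≡ 0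
  far≡0 s = 𝟙-elim (suc n ≤? deviation A s) (_≡ 0)
    (λ n<dev → contradiction (deviation-≤ A s) (<⇒≱ n<dev)) (λ _ → refl)

-- Membership in D quantifies over all partial sums, so the cut is made by the decidable test `Q`,
-- which implies membership. Minimality of a failing k gives the first half, and its failure drives
-- the tail bound of the second.
threshold : ∀ n t m .{{_ : NonZero n}} .{{_ : NonZero t}} → 4 ^ t ≤ m →
  ∃ λ k → (∀ j → ℤ.∣ j ∣ < k → InD n m t j) ×
          (∀ (A : Subset n) → 2 * m * ∑ (allSubsets n) (far k A) ^ t < 2 ^ (n * t))
threshold n t m 4ᵗ≤m = fromSearch (leastCounterexample Q? (suc n))
  where
  q M K N : ℕ
  -- As M is a multiple of n, the exponent kM/n = kq of the Chernoff parameter is an integer; as M ≥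
  -- 2tn², the condition 2tk² ≤ M + 1 holds for every k ≤ n.
  q = 2 * (t * (n * n))
  M = n * q
  K = suc M
  N = (2 * m) ^ (3 * n)
  instance
    n²≢0 : NonZero (n * n)
    n²≢0 = m*n≢0 n n
    tn²≢0 : NonZero (t * (n * n))
    tn²≢0 = m*n≢0 t (n * n)
    q≢0 : NonZero q
    q≢0 = m*n≢0 2 (t * (n * n))
    M≢0 : NonZero M
    M≢0 = m*n≢0 n q
  Q : ℕ → Set
  Q k = K ^ (K * (t * (k * k))) ≤ N * M ^ (K * (t * (k * k)))
  Q? : Decidable Q
  Q? k = K ^ (K * (t * (k * k))) ≤? N * M ^ (K * (t * (k * k)))
  Q⇒InD : ∀ {k} → (∀ j → j < k → Q j) → ∀ j → ℤ.∣ j ∣ < k → InD n m t j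
  Q⇒InD below j j<k = ExpLe-fromPower M (t * (ℤ.∣ j ∣ * ℤ.∣ j ∣)) N (below ℤ.∣ j ∣ j<k)
  tail : ∀ k → k ≤ n → ¬ Q k → (A : Subset n) → 2 * m * ∑ (allSubsets n) (far k A) ^ t < 2 ^ (n * t)
  tail k k≤n ¬Qk A = tail-fromHoeffding n t m M k (∑ (allSubsets n) (far k A)) 4ᵗ≤m 2y≤K (≰⇒> ¬Qk)
    (hoeffding-fromChernoff n q k _
      (chernoff (K ^ (k * q)) (M ^ (k * q)) {{m^n≢0 K (k * q)}} {{m^n≢0 M (k * q)}} (^-monoˡ-≤ (k * q) (n≤1+n M)) k A))
    where
    2y≤K : 2 * (t * (k * k)) ≤ K
    2y≤K = ≤-trans (*-monoʳ-≤ 2 (*-monoʳ-≤ t (*-mono-≤ k≤n k≤n)))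
             (≤-trans (m≤n*m q n) (n≤1+n M))
  fromSearch : (∀ j → j < suc n → Q j) ⊎ (∃ λ k → k < suc n × ¬ Q k × (∀ j → j < k → Q j)) → _
  fromSearch (inj₂ (k , s≤s k≤n , ¬Qk , below)) = k , Q⇒InD below , tail k k≤n ¬Qk
  -- When no value up to n fails the test, k = n + 1 exceeds every possible deviation, and no subset
  -- is far from any A.
  fromSearch (inj₁ below) = suc n , Q⇒InD below , λ A →
    subst (λ x → 2 * m * x ^ t < 2 ^ (n * t)) (sym (∑-far-suc A)) (empty t)
    where
    empty : ∀ t .{{_ : NonZero t}} → 2 * m * 0 ^ t < 2 ^ (n * t)
    empty (suc t) = subst (_< 2 ^ (n * suc t)) (sym (*-zeroʳ (2 * m))) (m^n>0 2 (n * suc t))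

-- The union bound

Near : ∀ {n} → ℕ → Subset n → Subset n → Set
Near k A A' = deviation A A' < k

Hits : ∀ {n t} → ℕ → List (Subset n) → Vec (Subset n) t → Set
Hits k F v = All (λ A → Any (Near k A) (toList v)) F

hits? : ∀ {n t} k (F : List (Subset n)) → Decidable (Hits {t = t} k F)
hits? k F v = all? (λ A → any? (λ A' → deviation A A' <? k) (toList v)) F

-- A failing tuple misses some A, and for this A every factor of the product of indicators is 1.
hits-or-far : ∀ {n t} k (F : List (Subset n)) (v : Vec (Subset n) t) →
  1 ≤ 𝟙 (hits? k F v) + ∑ F (λ A → ∏ (far k A) v)
hits-or-far k F v = 𝟙-elim (hits? k F v) (λ x → 1 ≤ x + ∑ F (λ A → ∏ (far k A) v))
  (λ _ → s≤s z≤n)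
  (λ ¬hits → Any⇒≤∑ (λ {A} → ∏-far A v)
    (¬All⇒Any¬ (λ A → any? (λ A' → deviation A A' <? k) (toList v)) F ¬hits))
  where
  ∏-far : ∀ {t} A (v : Vec _ t) → ¬ Any (Near k A) (toList v) → 1 ≤ ∏ (far k A) v
  ∏-far A [] _ = ≤-refl
  ∏-far A (A' ∷ v) ¬any = 𝟙-elim (k ≤? deviation A A') (λ x → 1 ≤ x * ∏ (far k A) v)
    (λ _ → ≤-trans (∏-far A v (¬any ∘ there)) (m≤m+n _ 0))
    (λ k≰dev → contradiction (here (≰⇒> k≰dev)) ¬any)

-- By the union bound, at most S of the T tuples fail. The tail bounds, averaged over the m sets,
-- give 2S < T, so more than half of the tuples succeed.
hits-majority : ∀ n t k (F : List (Subset n)) .{{_ : NonZero (length F)}} →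
  (∀ A → 2 * length F * ∑ (allSubsets n) (far k A) ^ t < 2 ^ (n * t)) →
  2 ^ (n * t) < 2 * length (filter (hits? k F) (allTuples n t))
hits-majority n t k F tail = +-cancelˡ-< (2 * S) _ _ (begin-strict
  2 * S + T       <⟨ +-monoˡ-< T 2S<T ⟩
  T + T           ≡⟨ double T ⟩
  2 * T           ≤⟨ *-monoʳ-≤ 2 T≤G+S ⟩
  2 * (G + S)     ≡⟨ rearr G S ⟩
  2 * S + 2 * G   ∎)
  where
  open ≤-Reasoning
  m = length F
  T = 2 ^ (n * t)
  G = length (filter (hits? k F) (allTuples n t))
  failures = λ A → ∑ (allSubsets n) (far k A) ^ t
  S = ∑ F failures
  double : ∀ a → a + a ≡ 2 * a
  double = solve-∀
  rearr : ∀ a b → 2 * (a + b) ≡ 2 * b + 2 * a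
  rearr = solve-∀
  factor : ∀ m s → m * suc (2 * s) ≡ 2 * m * s + m
  factor = solve-∀
  2S<T : 2 * S < T
  2S<T = *-cancelˡ-≤ m (≤-trans (≤-reflexive (factor m S)) (∑-average F (2 * m) T failures tail))
  T≤G+S : T ≤ G + S
  T≤G+S = begin
    T
      ≡⟨ ∑-allTuples-one n t ⟨
    ∑ (allTuples n t) (λ _ → 1)
      ≤⟨ ∑-mono-≤ (allTuples n t) (hits-or-far k F) ⟩
    ∑ (allTuples n t) (λ v → 𝟙 (hits? k F v) + ∑ F (λ A → ∏ (far k A) v))
      ≡⟨ ∑-+ (allTuples n t) (𝟙 ∘ hits? k F) _ ⟩
    ∑ (allTuples n t) (𝟙 ∘ hits? k F) + ∑ (allTuples n t) (λ v → ∑ F (λ A → ∏ (far k A) v))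
      ≡⟨ cong₂ _+_ (sym (length-filter-∑ (hits? k F) (allTuples n t)))
           (trans (∑-swap (allTuples n t) F _) (∑-cong F (λ A → ∑-allTuples n t (far k A)))) ⟩
    G + S ∎

length-deduplicate : ∀ (_≟_ : DecidableEquality A) xs → length (deduplicate _≟_ xs) ≤ length xs
length-deduplicate _≟_ [] = z≤n
length-deduplicate _≟_ (x ∷ xs) =
  s≤s (≤-trans (length-filter _ (deduplicate _≟_ xs)) (length-deduplicate _≟_ xs))

theorem2 : (n : ℕ) → 1 ≤ n → (F : List (Subset n)) → Unique F →
    (t : ℕ) → 1 ≤ t → 4 ^ t ≤ length F →
    (Σ (List (Subset n)) λ F' → Unique F' × length F' ≤ t × DSecting (InD n (length F) t) F F')
    × (Σ (List (Vec (Subset n) t)) λ good → Unique good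
    × All (λ v → DSecting (InD n (length F) t) F (toList v)) good
    × 2 ^ (n * t) < 2 * length good)
theorem2 n 1≤n F _ t 1≤t 4ᵗ≤m =
  family good good-secting majority ,
  good , Unique.filter⁺ (hits? k F) (allTuples-unique n t) , good-secting , majority
  where
  instance
    n≢0 : NonZero n
    n≢0 = >-nonZero 1≤n
    t≢0 : NonZero t
    t≢0 = >-nonZero 1≤t
    m≢0 : NonZero (length F)
    m≢0 = >-nonZero (≤-trans (m^n>0 4 t) 4ᵗ≤m)

  D = InD n (length F) t

  _≟ˢ_ : DecidableEquality (Subset n)
  _≟ˢ_ = ≡-dec _≟ᵇ_

  bound = threshold n t (length F) 4ᵗ≤m
  k = proj₁ bound
  good = filter (hits? k F) (allTuples n t)

  majority : 2 ^ (n * t) < 2 * length good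
  majority = hits-majority n t k F (proj₂ (proj₂ bound))

  hits⇒secting : ∀ {v : Vec (Subset n) t} → Hits k F v → DSecting D F (toList v)
  hits⇒secting hits {A} A∈F = Any.map (λ {A'} → proj₁ (proj₂ bound) (secDiff A A')) (All.lookup hits A∈F)

  good-secting : All (λ v → DSecting D F (toList v)) good
  good-secting = All.map (λ {v} → hits⇒secting {v}) (all-filter (hits? k F) (allTuples n t))

  family : ∀ vs → All (λ v → DSecting D F (toList v)) vs → 2 ^ (n * t) < 2 * length vs →
    Σ (List (Subset n)) λ F' → Unique F' × length F' ≤ t × DSecting D F F'
  -- An empty list would contradict the majority bound, so there is a first good tuple, and any good
  -- tuple will do.
  family (v ∷ _) (secting ∷ _) _ =
    -- Entries of a tuple may coincide, so the resulting family can have fewer than t members.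
    deduplicate _≟ˢ_ (toList v) ,
    DecUnique.deduplicate-! _≟ˢ_ (toList v) ,
    ≤-trans (length-deduplicate _≟ˢ_ (toList v)) (≤-reflexive (length-toList v)) ,
    λ A∈F → Any.deduplicate⁺ _≟ˢ_ (λ { refl d → d }) (secting A∈F)
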